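{- Let $G$ be a graph and let $k\ge 1$ be an integer. Then $G$ is a $k$-median graph if and only if there are $k$ (distinct) vertices $\mu_1,\dots,\mu_k\in V(G)$ such that $G$ satisfies (C1) w.r.t. each of $\mu_1,\dots,\mu_k$. In this case (i.e. whenever $G$ satisfies (C1) w.r.t. $\mu_1,\dots,\mu_k$), the vertices $\mu_1,\dots,\mu_k$ are median-consistent vertices of $G$.
   Context: All graphs are finite, simple and undirected. For $x,y\in V(G)$, the interval $I_G(x,y)$ is the set of all vertices lying on shortest $(x,y)$-paths in $G$ (it is empty if $x,y$ lie in different connected components), and $I_G(x,y,z):=I_G(x,y)\cap I_G(x,z)\cap I_G(y,z)$. A vertex $\mu\in V(G)$ is median-consistent in $G$ if $|I_G(\mu,x,y)|=1$ for all $x,y\in V(G)$. A graph is a $k$-median graph ($k\geq 1$) if it has (at least) $k$ median-consistent vertices. For $W\subseteq V(G)$, $G[W]$ denotes the subgraph induced by $W$. For $u\in V(G)$, $G$ satisfies (C1) w.r.t. $u$ if, for all $v,w\in V(G)$, the induced subgraph $G[I_G(u,v,w)]$ contains at least one vertex and is connected. -}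

module Defs where

open import Data.Fin.Base using (Fin)
open import Data.Fin.Subset using (Subset; ∣_∣)
import Data.Fin.Subset as Subset
open import Data.List.Base using (List; []; _∷_)
open import Data.List.Membership.Propositional using (_∈_)
open import Data.List.Relation.Unary.Unique.Propositional using (Unique)
open import Data.Nat.Base using (ℕ; zero; suc; _≤_)
open import Data.Product.Base using (∃-syntax; _×_)
open import Data.Refinement.Base using (Refinement; value)
open import Function.Definitions using (Injective)
open import Level using (0ℓ)
open import Relation.Binary.Core using (Rel)
open import Relation.Binary.Construct.Closure.ReflexiveTransitive
  using (Star; ε; _◅_)
open import Relation.Binary.Definitions using (Decidable; Irreflexive; Symmetric)
open import Relation.Binary.PropositionalEquality.Core using (_≡_; refl)
open import Relation.Unary using (Pred; Satisfiable; _∩_; _≐_)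

-- Simple undirected graphs with vertex set V; the finite ones are those over
-- Fin n.  For these, decidability of adjacency is vacuous classically and
-- makes the graph an explicit finite object.
record Graph (V : Set) : Set₁ where
  infix 4 _~_ _~?_
  field
    _~_      : Rel V 0ℓ
    _~?_     : Decidable _~_
    ~-sym    : Symmetric _~_
    ~-irrefl : Irreflexive _≡_ _~_

open Graph public using (_~?_; ~-sym; ~-irrefl)

module _ {V : Set} where

  Walk : Graph V → V → V → Set
  Walk G = Star (Graph._~_ G)

  module _ {G : Graph V} where

    vertices : ∀ {x y} → Walk G x y → List V
    vertices {x} ε       = x ∷ []
    vertices {x} (_ ◅ w) = x ∷ vertices w

    -- The number of edges.
    length : ∀ {x y} → Walk G x y → ℕ
    length ε       = zero
    length (_ ◅ w) = suc (length w)

  record Path (G : Graph V) (x y : V) : Set where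
    field
      walk     : Walk G x y
      distinct : Unique (vertices {G} walk)

    pathVertices : List V
    pathVertices = vertices {G} walk

    pathLength : ℕ
    pathLength = length {G} walk

  open Path public

  IsShortest : ∀ {G x y} → Path G x y → Set
  IsShortest {G} {x} {y} p = (q : Path G x y) → pathLength p ≤ pathLength q

  Interval : Graph V → V → V → Pred V 0ℓ
  Interval G x y v = ∃[ p ] IsShortest {G} {x} {y} p × v ∈ pathVertices p

  Interval₃ : Graph V → V → V → V → Pred V 0ℓ
  Interval₃ G x y z = Interval G x y ∩ Interval G x z ∩ Interval G y z

  Connected : Graph V → Set
  Connected G = ∀ x y → Path G x y

  -- The vertices are the v with W v; membership is a proof-irrelevant
  -- component, so different proofs of W v do not give different vertices.
  infix 20 _[_]
  _[_] : (G : Graph V) (W : Pred V 0ℓ) → Graph (Refinement V W)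
  G [ W ] = record
    { _~_      = λ a b → Graph._~_ G (value a) (value b)
    ; _~?_     = λ a b → _~?_ G (value a) (value b)
    ; ~-sym    = ~-sym G
    ; ~-irrefl = λ { refl → ~-irrefl G refl }
    }

C1 : ∀ {V} → Graph V → V → Set
C1 G u = ∀ v w → Satisfiable (Interval₃ G u v w) ×
                 Connected (G [ Interval₃ G u v w ])

module _ {n : ℕ} where

  -- The set of all v with P v has exactly k elements.
  HasCardinality : Pred (Fin n) 0ℓ → ℕ → Set
  HasCardinality P k = ∃[ S ] ((λ v → v Subset.∈ S) ≐ P) × ∣ S ∣ ≡ k

  MedianConsistent : Graph (Fin n) → Fin n → Set
  MedianConsistent G μ = ∀ x y → HasCardinality (Interval₃ G μ x y) 1

  -- At least k vertices are median-consistent.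
  IsKMedian : ℕ → Graph (Fin n) → Set
  IsKMedian k G = ∃[ μ ] Injective _≡_ _≡_ μ ×
                         ((i : Fin k) → MedianConsistent G (μ i))

{-# OPTIONS --safe #-}
-- A vertex x of I(u,v,w) satisfies 2 d(u,x) = d(u,v) + d(u,w) - d(v,w), so all
-- vertices of I(u,v,w) have the same distance to u.  Under (C1) two adjacent
-- vertices x, y never have the same distance to u: a vertex z of I(u,x,y) would
-- satisfy d(z,x) = d(z,y) and d(z,x) + d(z,y) = d(x,y) ≤ 1, so x = z = y.
-- Hence the connected graph G[I(u,v,w)] has no edge, i.e. a single vertex.
module Submission where

open import Defs
open import Data.Empty using (⊥; ⊥-elim-irr)
open import Data.Fin.Base using (Fin)
open import Data.Fin.Properties using (_≟_)
open import Data.Fin.Subset using (Subset; ∣_∣; ⁅_⁆)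
import Data.Fin.Subset as Subset
open import Data.Fin.Subset.Properties
  using (x∈⁅x⁆; x∈⁅y⁆⇒x≡y; ∣⁅x⁆∣≡1; nonempty?; Empty-unique; ∣⊥∣≡0;
         x∈p∧x≢y⇒x∈p-y; x∈p⇒∣p-x∣<∣p∣)
open import Data.Irrelevant using () renaming ([_] to irr)
open import Data.List.Base using (_∷_; [])
open import Data.List.Membership.Propositional using (_∈_)
import Data.List.Membership.DecPropositional as DecMembership
open import Data.List.Relation.Unary.All using ([])
open import Data.List.Relation.Unary.All.Properties using (¬Any⇒All¬)
open import Data.List.Relation.Unary.AllPairs using ([]; _∷_)
open import Data.List.Relation.Unary.Any using (here; there)
open import Data.List.Relation.Unary.Unique.Propositional using (Unique)
open import Data.Nat.Base using (ℕ; zero; suc; _+_; _*_; _≤_; s≤s)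
open import Data.Nat.Properties
  using (≤-refl; ≤-trans; ≤-antisym; ≤-reflexive; m≤n+m; +-comm;
         +-cancelˡ-≡; +-cancelˡ-≤; +-cancelʳ-≤; *-cancelˡ-≡; m+n≤o⇒n≤o; n≤1+n)
open import Data.Nat.Tactic.RingSolver using (solve-∀)
open import Data.Product.Base using (∃-syntax; _×_; _,_; proj₁; proj₂)
open import Data.Refinement.Base using (_,_)
open import Function.Base using (_∘_)
open import Function.Bundles using (_⇔_; mk⇔)
open import Function.Definitions using (Injective)
open import Level using (0ℓ)
open import Relation.Binary.Construct.Closure.ReflexiveTransitive
  using (ε; _◅_; _◅◅_)
open import Relation.Binary.Definitions using (DecidableEquality)
open import Relation.Binary.PropositionalEquality.Core
  using (_≡_; refl; sym; trans; cong; cong₂; subst; subst₂)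
open import Relation.Nullary.Decidable.Core using (yes; no; recompute)
open import Relation.Unary using (Pred; Satisfiable)

-- The first two sums minus the third leave `2 * a`. Below, `a`, `b`, `c` are the distances from a
-- vertex of I(u,v,w) to u, v, w, and the sums are the distances between u, v, w.
pairwise-sums-injective : ∀ {a b c a′ b′ c′} →
  a + b ≡ a′ + b′ → a + c ≡ a′ + c′ → b + c ≡ b′ + c′ → a ≡ a′
pairwise-sums-injective {a} {b} {c} {a′} {b′} {c′} ab ac bc =
  *-cancelˡ-≡ a a′ 2 (+-cancelˡ-≡ (b + c) _ _
    (trans (rearrange a b c) (trans (cong₂ _+_ ab ac)
      (trans (sym (rearrange a′ b′ c′)) (cong (_+ 2 * a′) (sym bc))))))
  where
  rearrange : ∀ a b c → (b + c) + 2 * a ≡ (a + b) + (a + c)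
  rearrange = solve-∀

n+n≤1⇒n≡0 : ∀ n → n + n ≤ 1 → n ≡ 0
n+n≤1⇒n≡0 zero    _       = refl
n+n≤1⇒n≡0 (suc n) (s≤s h) with m+n≤o⇒n≤o n h
... | ()

-- Walks and distances

module _ {V : Set} {G : Graph V} where

  open Graph G using (_~_)

  length-◅◅ : ∀ {x y z} (p : Walk G x y) (q : Walk G y z) →
    length {G = G} (p ◅◅ q) ≡ length {G = G} p + length {G = G} q
  length-◅◅ ε       q = refl
  length-◅◅ (_ ◅ p) q = cong suc (length-◅◅ p q)

  reverse-walk : ∀ {x y} (p : Walk G x y) →
    ∃[ q ] length {G = G} {y} {x} q ≡ length {G = G} p
  reverse-walk ε = ε , refl
  reverse-walk (e ◅ p) with reverse-walk p
  ... | q , eq = q ◅◅ (~-sym G e ◅ ε) ,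
    trans (length-◅◅ q _) (trans (+-comm _ 1) (cong suc eq))

  -- Distinctness is tracked for the final piece only, which is the one kept when a cycle is cut
  -- off.
  split-walk : ∀ {x y v} (w : Walk G x y) → v ∈ vertices {G = G} w →
    ∃[ p ] ∃[ q ] length {G = G} {x} {v} p + length {G = G} {v} {y} q ≡ length {G = G} w
      × (Unique (vertices {G = G} w) → Unique (vertices {G = G} q))
  split-walk ε       (here refl) = ε , ε , refl , λ u → u
  split-walk (e ◅ w) (here refl) = ε , e ◅ w , refl , λ u → u
  split-walk (e ◅ w) (there v∈)  with split-walk w v∈
  ... | p , q , eq , uniq = e ◅ p , q , cong suc eq , λ { (_ ∷ u) → uniq u }

  -- A relation, since vertices in different components have no distance. Minimality ranges over
  -- walks, so that concatenations can be compared directly.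
  record IsDistance (x y : V) (d : ℕ) : Set where
    field
      walk       : Walk G x y
      length≡    : length {G = G} walk ≡ d
      is-minimal : (w : Walk G x y) → d ≤ length {G = G} w

  open IsDistance

  distance-unique : ∀ {x y c d} → IsDistance x y c → IsDistance x y d → c ≡ d
  distance-unique p q = ≤-antisym
    (≤-trans (is-minimal p (walk q)) (≤-reflexive (length≡ q)))
    (≤-trans (is-minimal q (walk p)) (≤-reflexive (length≡ p)))

  distance-sym : ∀ {x y d} → IsDistance x y d → IsDistance y x d
  distance-sym p with reverse-walk (walk p)
  ... | q , eq = record
    { walk       = q
    ; length≡    = trans eq (length≡ p)
    ; is-minimal = λ w → subst (_ ≤_) (proj₂ (reverse-walk w))
                           (is-minimal p (proj₁ (reverse-walk w)))
    }

  distance-0⇒≡ : ∀ {x y d} → IsDistance x y d → d ≡ 0 → x ≡ y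
  distance-0⇒≡ p refl with walk p | length≡ p
  ... | ε | _ = refl

  -- Metric betweenness: d(x,y) = d(x,v) + d(v,y), with all three distances finite.
  record Between (x y v : V) : Set where
    field
      {dˡ dʳ}        : ℕ
      left-distance  : IsDistance x v dˡ
      right-distance : IsDistance v y dʳ
      distance       : IsDistance x y (dˡ + dʳ)

  open Between

  -- Intervals and the effect of (C1)

  module _ (_≟ⱽ_ : DecidableEquality V) where

    open DecMembership _≟ⱽ_ using (_∈?_)

    walk⇒path : ∀ {x y} (w : Walk G x y) →
      ∃[ p ] pathLength {G = G} {x} {y} p ≤ length {G = G} w
    walk⇒path ε = record { walk = ε ; distinct = [] ∷ [] } , ≤-refl
    walk⇒path {x} (e ◅ w) with walk⇒path w
    ... | p , p≤w with x ∈? pathVertices p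
    ...   | no x∉p = record { walk = e ◅ Path.walk p
                            ; distinct = ¬Any⇒All¬ _ x∉p ∷ distinct p } , s≤s p≤w
    -- The new edge would close a cycle at `x`; only the part of `p` from `x` onwards is kept.
    ...   | yes x∈p with split-walk (Path.walk p) x∈p
    ...     | p₁ , p₂ , eq , uniq = record { walk = p₂ ; distinct = uniq (distinct p) } ,
      ≤-trans (m≤n+m _ (length {G = G} p₁))
        (≤-trans (≤-reflexive eq) (≤-trans p≤w (n≤1+n _)))

    shortest-minimal : ∀ {x y} (p : Path G x y) → IsShortest {G = G} p →
      (w : Walk G x y) → pathLength {G = G} p ≤ length {G = G} w
    shortest-minimal _ sh w = ≤-trans (sh (proj₁ (walk⇒path w))) (proj₂ (walk⇒path w))

    -- Both pieces of a shortest path are shortest: a shorter replacement for one of them, joined to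
    -- the other, would give a shorter walk from `x` to `y`.
    interval⇒between : ∀ {x y v} → Interval G x y v → Between x y v
    interval⇒between (p , sh , v∈p) with split-walk (Path.walk p) v∈p
    ... | p₁ , p₂ , eq , _ = record
      { left-distance  = record { walk = p₁ ; length≡ = refl ; is-minimal = λ w →
          +-cancelʳ-≤ (length {G = G} p₂) _ _ (minimal w p₂) }
      ; right-distance = record { walk = p₂ ; length≡ = refl ; is-minimal = λ w →
          +-cancelˡ-≤ (length {G = G} p₁) _ _ (minimal p₁ w) }
      ; distance       = record { walk = Path.walk p ; length≡ = sym eq ; is-minimal = λ w →
          subst (_≤ length {G = G} w) (sym eq) (shortest-minimal p sh w) }
      }
      where
      minimal : ∀ w₁ w₂ → length {G = G} p₁ + length {G = G} p₂
                        ≤ length {G = G} w₁ + length {G = G} w₂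
      minimal w₁ w₂ = subst₂ _≤_ (sym eq) (length-◅◅ w₁ w₂) (shortest-minimal p sh (w₁ ◅◅ w₂))

    interval₃-equidistant : ∀ {u v w x y} →
      Interval₃ G u v w x → Interval₃ G u v w y →
      ∃[ d ] IsDistance u x d × IsDistance u y d
    interval₃-equidistant (uvx , uwx , vwx) (uvy , uwy , vwy) =
      dˡ bx , left-distance bx , subst (IsDistance _ _) (sym dx≡dy) (left-distance by)
      where
      bx = interval⇒between uvx
      by = interval⇒between uvy
      cx = interval⇒between uwx
      cy = interval⇒between uwy

      -- Each `Between` carries its own numbers; `d-vw` and `d-uw` rewrite the distances in terms of
      -- one common triple d(u,x), d(v,x), d(w,x).
      d-vw : ∀ {u v w x} (uv : Between u v x) (uw : Between u w x) → Between v w x →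
        IsDistance v w (dʳ uv + dʳ uw)
      d-vw uv uw vw = subst (IsDistance _ _)
        (cong₂ _+_ (distance-unique (left-distance vw) (distance-sym (right-distance uv)))
                   (distance-unique (right-distance vw) (right-distance uw)))
        (distance vw)

      d-uw : ∀ {u v w x} (uv : Between u v x) (uw : Between u w x) →
        IsDistance u w (dˡ uv + dʳ uw)
      d-uw uv uw = subst (λ a → IsDistance _ _ (a + dʳ uw))
        (distance-unique (left-distance uw) (left-distance uv)) (distance uw)

      dx≡dy : dˡ bx ≡ dˡ by
      dx≡dy = pairwise-sums-injective
        (distance-unique (distance bx) (distance by))
        (distance-unique (d-uw bx cx) (d-uw by cy))
        (distance-unique (d-vw bx cx (interval⇒between vwx))
                         (d-vw by cy (interval⇒between vwy)))

    equidistant⇒¬adjacent : ∀ {u x y d} → Satisfiable (Interval₃ G u x y) →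
      IsDistance u x d → IsDistance u y d → x ~ y → ⊥
    equidistant⇒¬adjacent {x = x} {y} (z , uxz , uyz , xyz) ux uy e =
      ~-irrefl G (trans (distance-0⇒≡ (left-distance bxy) p≡0)
                        (distance-0⇒≡ (right-distance bxy) (trans (sym p≡q) p≡0))) e
      where
      bux = interval⇒between uxz
      buy = interval⇒between uyz
      bxy = interval⇒between xyz

      -- Both d(z,x) and d(z,y) add up with d(u,z) to the common distance `d`.
      p≡q : dˡ bxy ≡ dʳ bxy
      p≡q = trans
        (distance-unique (distance-sym (left-distance bxy)) (right-distance bux))
        (trans (+-cancelˡ-≡ (dˡ bux) _ _
          (trans (distance-unique (distance bux) ux)
            (trans (distance-unique uy (distance buy))
              (cong (_+ dʳ buy) (distance-unique (left-distance buy) (left-distance bux))))))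
          (distance-unique (right-distance buy) (right-distance bxy)))

      p≡0 : dˡ bxy ≡ 0
      p≡0 = n+n≤1⇒n≡0 _ (subst (λ q → dˡ bxy + q ≤ 1) (sym p≡q)
        (is-minimal (distance bxy) (e ◅ ε)))

    C1⇒interval₃-unique : ∀ {u v w x y} → C1 G u →
      Interval₃ G u v w x → Interval₃ G u v w y → x ≡ y
    C1⇒interval₃-unique {u} {v} {w} {x} {y} c1 x∈ y∈
      with Path.walk (proj₂ (c1 v w) (x , irr x∈) (y , irr y∈))
    ... | ε = refl
    -- The first edge already leads to a contradiction, for which the irrelevant membership proof of
    -- `z` is enough.
    ... | _◅_ {j = z , irr z∈} e _ = ⊥-elim-irr (no-edge z∈)
      where
      no-edge : Interval₃ G u v w z → ⊥
      no-edge z∈ with interval₃-equidistant x∈ z∈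
      -- Here (C1) is applied to the adjacent pair `x`, `z` instead of `v`, `w`.
      ... | _ , dx , dz = equidistant⇒¬adjacent (proj₁ (c1 x z)) dx dz e

-- Sets of size one and the equivalence at a single vertex

module _ {n : ℕ} where

  ∣p∣≡1⇒nonempty : (p : Subset n) → ∣ p ∣ ≡ 1 → Subset.Nonempty p
  ∣p∣≡1⇒nonempty p ∣p∣≡1 with nonempty? p
  ... | yes ne = ne
  ... | no ¬ne with trans (sym ∣p∣≡1) (trans (cong ∣_∣ (Empty-unique ¬ne)) (∣⊥∣≡0 n))
  ...   | ()

  ∣p∣≡1⇒unique : ∀ {p : Subset n} {x y} → ∣ p ∣ ≡ 1 → x Subset.∈ p → y Subset.∈ p → x ≡ y
  ∣p∣≡1⇒unique {p} {x} {y} ∣p∣≡1 x∈p y∈p with x ≟ y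
  ... | yes x≡y = x≡y
  ... | no  x≢y
    -- Removing `y` and then `x` lowers the size twice, which is impossible from 1.
    with ≤-trans (s≤s (x∈p⇒∣p-x∣<∣p∣ (x∈p∧x≢y⇒x∈p-y x∈p x≢y)))
                 (≤-trans (x∈p⇒∣p-x∣<∣p∣ y∈p) (≤-reflexive ∣p∣≡1))
  ...   | s≤s ()

  unique⇒cardinality-1 : ∀ {P : Pred (Fin n) 0ℓ} → Satisfiable P →
    (∀ {x y} → P x → P y → x ≡ y) → HasCardinality P 1
  unique⇒cardinality-1 {P} (m , Pm) unique = ⁅ m ⁆ ,
    ((λ v∈ → subst P (sym (x∈⁅y⁆⇒x≡y m v∈)) Pm) ,
     (λ Pv → subst (Subset._∈ ⁅ m ⁆) (unique Pm Pv) (x∈⁅x⁆ m))) ,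
    ∣⁅x⁆∣≡1 m

  cardinality-1⇒connected : (G : Graph (Fin n)) {P : Pred (Fin n) 0ℓ} →
    HasCardinality P 1 → Connected (G [ P ])
  cardinality-1⇒connected G {P} (S , (_ , P⊆S) , ∣S∣≡1) (x , irr Px) (y , irr Py)
    -- `Px` and `Py` are irrelevant, so the equality they yield is recovered by deciding `x ≟ y`.
    with recompute (x ≟ y) (∣p∣≡1⇒unique ∣S∣≡1 (P⊆S Px) (P⊆S Py))
  ... | refl = record { walk = ε ; distinct = [] ∷ [] }

  medianConsistent⇒C1 : (G : Graph (Fin n)) {μ : Fin n} → MedianConsistent G μ → C1 G μ
  medianConsistent⇒C1 G mc v w with mc v w
  ... | card@(S , (S⊆ , _) , ∣S∣≡1) with ∣p∣≡1⇒nonempty S ∣S∣≡1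
  ...   | x , x∈S = (x , S⊆ x∈S) , cardinality-1⇒connected G card

  C1⇒medianConsistent : (G : Graph (Fin n)) {μ : Fin n} → C1 G μ → MedianConsistent G μ
  C1⇒medianConsistent G c1 v w =
    unique⇒cardinality-1 (proj₁ (c1 v w)) (C1⇒interval₃-unique _≟_ c1)

mainTheorem2 : ∀ {n : ℕ} (G : Graph (Fin n)) (k : ℕ) → 1 ≤ k →
    (IsKMedian k G ⇔ (∃[ μ ] Injective _≡_ _≡_ μ × ((i : Fin k) → C1 G (μ i)))) ×
    ((μ : Fin k → Fin n) → Injective _≡_ _≡_ μ →
    ((i : Fin k) → C1 G (μ i)) → (i : Fin k) → MedianConsistent G (μ i))
mainTheorem2 G k _ =
  mk⇔ (λ { (μ , inj , mc) → μ , inj , medianConsistent⇒C1 G ∘ mc })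
      (λ { (μ , inj , c1) → μ , inj , C1⇒medianConsistent G ∘ c1 }) ,
  λ μ _ c1 → C1⇒medianConsistent G ∘ c1
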